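{- Let $n\ge 2$ be an integer. Then it is possible to place $n-2$ queens on $\mathbb{Z}_n^2$ with no two in conflict.
   Context: Queens on the toroidal board $\mathbb{Z}_n^2$ occupy distinct fields; two queens at $(x,y)$ and $(x',y')$ are in conflict iff $x=x'$, or $y=y'$, or $x+y=x'+y'$, or $x-y=x'-y'$ in $\mathbb{Z}_n$. -}

module Defs where

open import Data.Nat using (ℕ; _+_; _∸_; _%_; NonZero)
open import Data.Fin using (Fin; toℕ)
open import Data.Product using (_×_; _,_)
open import Data.Sum using (_⊎_)
open import Relation.Binary.PropositionalEquality using (_≡_)
open import Relation.Nullary using (¬_)

Field : ℕ → Set
Field n = Fin n × Fin n

sumMod : (n : ℕ) .{{_ : NonZero n}} → Fin n → Fin n → ℕ
sumMod n x y = (toℕ x + toℕ y) % n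

diffMod : (n : ℕ) .{{_ : NonZero n}} → Fin n → Fin n → ℕ
diffMod n x y = (toℕ x + (n ∸ toℕ y)) % n

Conflict : (n : ℕ) .{{_ : NonZero n}} → Field n → Field n → Set
Conflict n (x , y) (x' , y') =
  x ≡ x' ⊎ y ≡ y' ⊎ sumMod n x y ≡ sumMod n x' y' ⊎ diffMod n x y ≡ diffMod n x' y'

NonAttacking : (n : ℕ) .{{_ : NonZero n}} (k : ℕ) → (Fin k → Field n) → Set
NonAttacking n k q =
  (∀ i j → q i ≡ q j → i ≡ j) × (∀ i j → ¬ i ≡ j → ¬ Conflict n (q i) (q j))

{-# OPTIONS --safe #-}

-- Write n = 2 + r + 12m with r < 12.  The i-th of the n - 2 queens stands on
-- (i + d , 3i + d + g), where d and g are constant on each of at most seven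
-- intervals of indices whose endpoints are affine in m.  On every one of the four
-- kinds of lines the line of queen i is then λi + f with 1 ≤ λ ≤ 4 and f constant on
-- each interval.  So i < j conflict only if λj + f′ = λi + f + kn for one of
-- finitely many k; for each k this is excluded either modulo λ (which divides 12,
-- hence n mod λ does not depend on m), or by comparing coefficients of m in
-- the bounds for i and j.  The intervals were found by computer search.
module Submission where

open import Defs
open import Data.Fin using (Fin; toℕ)
import Data.Fin.Properties as Fin
open import Data.List using (List; []; _∷_; upTo)
open import Data.List.Membership.Propositional using (_∈_)
open import Data.List.Membership.Propositional.Properties using (∈-upTo⁺)
open import Data.List.Relation.Unary.All as All using (All; all?)
open import Data.List.Relation.Unary.Any using (here; there)
open import Data.Nat using (ℕ; suc; _+_; _*_; _∸_; _%_; _/_; _≤_; _<_; _≤?_; _<?_; _≟_; z≤n; s≤s; NonZero; ∣_-_∣)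
open import Data.Nat.Divisibility using (_∣_; _∣?_; divides; m∣m*n; ∣m+n∣m⇒∣n; ∣m∣n⇒∣m+n; ∣n⇒∣m*n)
open import Data.Nat.DivMod using (_mod_; _divMod_; result; m≡m%n+[m/n]*n; m%n<n)
open import Data.Nat.Properties
open import Data.Nat.Tactic.RingSolver using (solve-∀)
open import Data.Product using (Σ; ∃; _×_; _,_; proj₁)
open import Data.Product.Properties using (≡-dec)
open import Data.Sum using (_⊎_; inj₁; inj₂)
open import Data.Vec using (Vec; []; _∷_; lookup)
open import Relation.Binary.Definitions using (tri<; tri≈; tri>)
open import Relation.Binary.PropositionalEquality
open import Relation.Nullary using (¬_; Dec; yes; no; contradiction; ¬?; _×-dec_; _⊎-dec_)
open import Relation.Nullary.Decidable using (from-yes)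

-- Congruence

infix 4 _≈_[mod_]

-- Allowing a multiple of n on both sides keeps congruence inside ℕ: no subtraction, and symmetry is
-- immediate.
record _≈_[mod_] (a b n : ℕ) : Set where
  constructor congruent
  field
    p q : ℕ
    eq  : a + p * n ≡ b + q * n

module _ {n : ℕ} where

  ≈-reflexive : ∀ {a b} → a ≡ b → a ≈ b [mod n ]
  ≈-reflexive refl = congruent 0 0 refl

  ≈-sym : ∀ {a b} → a ≈ b [mod n ] → b ≈ a [mod n ]
  ≈-sym (congruent p q eq) = congruent q p (sym eq)

  ≈-trans : ∀ {a b c} → a ≈ b [mod n ] → b ≈ c [mod n ] → a ≈ c [mod n ]
  ≈-trans {a} {b} {c} (congruent p q eq) (congruent p′ q′ eq′) = congruent (p + p′) (q′ + q) (begin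
    a + (p + p′) * n      ≡⟨ regroup a p p′ n ⟩
    a + p * n + p′ * n    ≡⟨ cong (_+ p′ * n) eq ⟩
    b + q * n + p′ * n    ≡⟨ swap b q p′ n ⟩
    b + p′ * n + q * n    ≡⟨ cong (_+ q * n) eq′ ⟩
    c + q′ * n + q * n    ≡⟨ regroup c q′ q n ⟨
    c + (q′ + q) * n      ∎)
    where
    open ≡-Reasoning
    regroup : ∀ a p q n → a + (p + q) * n ≡ a + p * n + q * n
    regroup = solve-∀
    swap : ∀ a p q n → a + p * n + q * n ≡ a + q * n + p * n
    swap = solve-∀

  ≈-+-cong : ∀ {a b c d} → a ≈ b [mod n ] → c ≈ d [mod n ] → a + c ≈ b + d [mod n ]
  ≈-+-cong {a} {b} {c} {d} (congruent p q eq) (congruent p′ q′ eq′) =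
    congruent (p + p′) (q + q′) (trans (interchange a c p p′ n) (trans (cong₂ _+_ eq eq′) (sym (interchange b d q q′ n))))
    where
    interchange : ∀ a c p q n → a + c + (p + q) * n ≡ (a + p * n) + (c + q * n)
    interchange = solve-∀

  ≈-+-congˡ : ∀ c {a b} → a ≈ b [mod n ] → c + a ≈ c + b [mod n ]
  ≈-+-congˡ c = ≈-+-cong (≈-reflexive (refl {x = c}))

  ≈-+-congʳ : ∀ c {a b} → a ≈ b [mod n ] → a + c ≈ b + c [mod n ]
  ≈-+-congʳ c a≈b = ≈-+-cong a≈b (≈-reflexive (refl {x = c}))

  ≈-+-cancelʳ : ∀ {a b} c → a + c ≈ b + c [mod n ] → a ≈ b [mod n ]
  ≈-+-cancelʳ {a} {b} c (congruent p q eq) =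
    congruent p q (+-cancelʳ-≡ c _ _ (trans (swap a p c n) (trans eq (sym (swap b q c n)))))
    where
    swap : ∀ a p c n → a + p * n + c ≡ a + c + p * n
    swap = solve-∀

  %≈ : ∀ a .{{_ : NonZero n}} → a % n ≈ a [mod n ]
  %≈ a = congruent (a / n) 0 (trans (sym (m≡m%n+[m/n]*n a n)) (sym (+-identityʳ a)))

  mod≈ : ∀ a .{{_ : NonZero n}} → toℕ (a mod n) ≈ a [mod n ]
  mod≈ a = ≈-trans (≈-reflexive (Fin.toℕ-fromℕ< (m%n<n a n))) (%≈ a)

  %≡⇒≈ : ∀ {a b} .{{_ : NonZero n}} → a % n ≡ b % n → a ≈ b [mod n ]
  %≡⇒≈ {a} {b} eq = ≈-trans (≈-sym (%≈ a)) (≈-trans (≈-reflexive eq) (%≈ b))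

  mod≡⇒≈ : ∀ {a b} .{{_ : NonZero n}} → a mod n ≡ b mod n → a ≈ b [mod n ]
  mod≡⇒≈ {a} {b} eq = ≈-trans (≈-sym (mod≈ a)) (≈-trans (≈-reflexive (cong toℕ eq)) (mod≈ b))

  -- The smaller of the two multiples of n cancels. The `suc k` leaves equality to the first
  -- alternative.
  ≈⇒difference : ∀ {a b} → a ≈ b [mod n ] → (∃ λ k → a ≡ b + k * n) ⊎ (∃ λ k → b ≡ a + suc k * n)
  ≈⇒difference {a} {b} (congruent p q eq) with p ≤? q
  ... | yes p≤q with k , refl ← m≤n⇒∃[o]m+o≡n p≤q =
    inj₁ (k , +-cancelʳ-≡ (p * n) _ _ (trans eq (regroup b p k n)))
    where
    regroup : ∀ b p k n → b + (p + k) * n ≡ b + k * n + p * n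
    regroup = solve-∀
  ... | no  p≰q with k , refl ← m≤n⇒∃[o]m+o≡n (≰⇒> p≰q) =
    inj₂ (k , +-cancelʳ-≡ (q * n) _ _ (trans (sym eq) (regroup a q k n)))
    where
    regroup : ∀ a q k n → a + suc (q + k) * n ≡ a + suc k * n + q * n
    regroup = solve-∀

-- Cancelling the smaller of a and b leaves x and y differing by exactly the distance.
∣-distance : ∀ {c x y a b} → c ∣ x → c ∣ y → x + a ≡ y + b → c ∣ ∣ a - b ∣
∣-distance {c} {x} {y} {a} {b} c∣x c∣y eq with ≤-total a b
... | inj₁ a≤b with k , refl ← m≤n⇒∃[o]m+o≡n a≤b =
  subst (c ∣_) (sym (∣m-m+n∣≡n a k)) (∣m+n∣m⇒∣n (subst (c ∣_) x≡y+k c∣x) c∣y)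
  where
  x≡y+k : x ≡ y + k
  x≡y+k = +-cancelʳ-≡ a _ _ (trans eq (trans (cong (y +_) (+-comm a k)) (sym (+-assoc y k a))))
... | inj₂ b≤a with k , refl ← m≤n⇒∃[o]m+o≡n b≤a =
  subst (c ∣_) (sym (trans (∣-∣-comm (b + k) b) (∣m-m+n∣≡n b k))) (∣m+n∣m⇒∣n (subst (c ∣_) y≡x+k c∣y) c∣x)
  where
  y≡x+k : y ≡ x + k
  y≡x+k = +-cancelʳ-≡ b _ _ (trans (sym eq) (trans (cong (x +_) (+-comm b k)) (sym (+-assoc x k b))))

-- Affine functions of m

-- (a , b) stands for m ↦ b + m * a.
Affine : Set
Affine = ℕ × ℕ

infixl 6 _⊕_
infixl 7 _⊙_
infix 4 _≼_ _≺_ _≼?_ _≺?_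

_⊕_ : Affine → Affine → Affine
(a , b) ⊕ (a′ , b′) = a + a′ , b + b′

_⊙_ : ℕ → Affine → Affine
c ⊙ (a , b) = c * a , c * b

const : ℕ → Affine
const c = 0 , c

-- Comparing coefficients is decidable without m and suffices for the inequality at every m.
-- Strictness sits in the constant terms because m may be 0.
_≼_ _≺_ : Affine → Affine → Set
(a , b) ≼ (a′ , b′) = a ≤ a′ × b ≤ b′
(a , b) ≺ (a′ , b′) = a ≤ a′ × b < b′

_≼?_ : ∀ p q → Dec (p ≼ q)
(a , b) ≼? (a′ , b′) = a ≤? a′ ×-dec b ≤? b′

_≺?_ : ∀ p q → Dec (p ≺ q)
(a , b) ≺? (a′ , b′) = a ≤? a′ ×-dec b <? b′

module _ (m : ℕ) where

  eval : Affine → ℕ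
  eval (a , b) = b + m * a

  eval-mono-≼ : ∀ {p q} → p ≼ q → eval p ≤ eval q
  eval-mono-≼ (a≤ , b≤) = +-mono-≤ b≤ (*-monoʳ-≤ m a≤)

  eval-mono-≺ : ∀ {p q} → p ≺ q → eval p < eval q
  eval-mono-≺ (a≤ , b<) = +-mono-<-≤ b< (*-monoʳ-≤ m a≤)

  eval-⊕ : ∀ p q → eval (p ⊕ q) ≡ eval p + eval q
  eval-⊕ (a , b) (a′ , b′) = identity m a b a′ b′
    where
    identity : ∀ m a b a′ b′ → b + b′ + m * (a + a′) ≡ b + m * a + (b′ + m * a′)
    identity = solve-∀

  eval-⊙ : ∀ c p → eval (c ⊙ p) ≡ c * eval p
  eval-⊙ c (a , b) = identity m c a b
    where
    identity : ∀ m c a b → c * b + m * (c * a) ≡ c * (b + m * a)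
    identity = solve-∀

  eval-const : ∀ c → eval (const c) ≡ c
  eval-const c = trans (cong (c +_) (*-zeroʳ m)) (+-identityʳ c)

-- Configurations

-- Storing lengths instead of endpoints makes the intervals tile the index range by construction.
record Run : Set where
  constructor run
  field
    size : Affine
    d g  : ℕ

record Piece : Set where
  constructor piece
  field
    lo hi : Affine
    d g   : ℕ

open Piece

pieces : Affine → List Run → List Piece
pieces p []                = []
pieces p (run s d g ∷ rs) = piece p (p ⊕ s) d g ∷ pieces (p ⊕ s) rs

end : Affine → List Run → Affine
end p []                = p
end p (run s d g ∷ rs) = end (p ⊕ s) rs

record Located (m : ℕ) (A : Piece) (i : ℕ) : Set where
  constructor located
  field
    lo≤ : eval m (lo A) ≤ i
    <hi : i < eval m (hi A)

locate : ∀ m p rs i → eval m p ≤ i → i < eval m (end p rs) → ∃ λ A → A ∈ pieces p rs × Located m A i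
locate m p []                i p≤i i<e = contradiction (≤-<-trans p≤i i<e) (<-irrefl refl)
locate m p (run s d g ∷ rs) i p≤i i<e with i <? eval m (p ⊕ s)
... | yes i<hi = piece p (p ⊕ s) d g , here refl , located p≤i i<hi
... | no  i≮hi with A , A∈ , loc ← locate m (p ⊕ s) rs i (≮⇒≥ i≮hi) i<e = A , there A∈ , loc

-- For a line λi + f, `step` is λ, while `μ` and `ν` are the weights of d and g in f.
record Line : Set where
  constructor line
  field
    step  : ℕ
    μ ν   : ℕ
    step∣12 : step ∣ 12

open Line

offset : Line → Piece → ℕ
offset ℓ A = μ ℓ * d A + ν ℓ * g A

value : Line → Piece → ℕ → ℕ
value ℓ A i = step ℓ * i + offset ℓ A

-- `difference` is row minus column, 2i + g, where d cancels; `sum` is 4i + 2d + g.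
column difference row sum : Line
column     = line 1 1 0 (divides 12 refl)
difference = line 2 0 1 (divides 6 refl)
row        = line 3 1 1 (divides 4 refl)
sum        = line 4 2 1 (divides 3 refl)

column+row : ∀ A i → value column A i + value row A i ≡ value sum A i
column+row A i = identity i (d A) (g A)
  where
  identity : ∀ i d g → (1 * i + (1 * d + 0 * g)) + (3 * i + (1 * d + 1 * g)) ≡ 4 * i + (2 * d + 1 * g)
  identity = solve-∀

difference+column : ∀ A i → value difference A i + value column A i ≡ value row A i
difference+column A i = identity i (d A) (g A)
  where
  identity : ∀ i d g → (2 * i + (0 * d + 1 * g)) + (1 * i + (1 * d + 0 * g)) ≡ 3 * i + (1 * d + 1 * g)
  identity = solve-∀

lines : List Line
lines = column ∷ difference ∷ row ∷ sum ∷ []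

-- Separation certificates

-- N is the constant term of n = N + m * 12.
module Separation (N : ℕ) where

  -- From i < j the value at j gains at least one `step`; the test asks that this gain, together
  -- with x, outweigh any drop in offset.
  Near : Line → Piece → Piece → ℕ → Set
  Near ℓ A B x = offset ℓ A < step ℓ + offset ℓ B + x

  -- Each of the first four refutes value B j ≡ value A i + k * n for i < j in A and B.
  Below Above Adjacent Incongruent Excluded : Line → Piece → Piece → ℕ → Set
  Below ℓ A B k = step ℓ ⊙ hi B ⊕ const (offset ℓ B) ≺ step ℓ ⊙ lo A ⊕ const (step ℓ + offset ℓ A) ⊕ k ⊙ (12 , N)
  Above ℓ A B k = step ℓ ⊙ hi A ⊕ const (offset ℓ A) ⊕ k ⊙ (12 , N) ≺ step ℓ ⊙ lo B ⊕ const (step ℓ + offset ℓ B)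
  Adjacent ℓ A B k = k ≡ 0 × Near ℓ A B 0
  Incongruent ℓ A B k = ¬ step ℓ ∣ ∣ offset ℓ B - offset ℓ A + k * N ∣
  Excluded ℓ A B k = Incongruent ℓ A B k ⊎ Adjacent ℓ A B k ⊎ Above ℓ A B k ⊎ Below ℓ A B k

  -- Reduces all integers k to finitely many: `Near` at `N` handles negative k, `Below` at
  -- `step + 1` handles every k above `step`, and 0 to `step` are checked singly.
  SeparatedOn : Piece → Piece → Line → Set
  SeparatedOn A B ℓ =
    Near ℓ A B N × Below ℓ A B (suc (step ℓ)) × All (Excluded ℓ A B) (upTo (suc (step ℓ)))

  -- In the first alternative no index of A precedes one of B, so the pair is vacuous for i < j.
  Separated : Piece → Piece → Set
  Separated A B = hi B ≼ lo A ⊎ All (SeparatedOn A B) lines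

  below? : ∀ ℓ A B k → Dec (Below ℓ A B k)
  below? ℓ A B k = _ ≺? _

  excluded? : ∀ ℓ A B k → Dec (Excluded ℓ A B k)
  excluded? ℓ A B k =
    ¬? (_ ∣? _) ⊎-dec ((k ≟ 0) ×-dec (_ <? _)) ⊎-dec (_ ≺? _) ⊎-dec below? ℓ A B k

  separated? : ∀ A B → Dec (Separated A B)
  separated? A B = (hi B ≼? lo A) ⊎-dec all? (λ ℓ →
    (_ <? _) ×-dec below? ℓ A B (suc (step ℓ)) ×-dec all? (excluded? ℓ A B) (upTo (suc (step ℓ)))) lines

  -- Soundness of the separation tests for every m

  module _ (m : ℕ) where

    private
      n = eval m (12 , N)

    eval-line : ∀ c p f → eval m (c ⊙ p ⊕ const f) ≡ c * eval m p + f
    eval-line c p f = trans (eval-⊕ m (c ⊙ p) (const f)) (cong₂ _+_ (eval-⊙ m c p) (eval-const m f))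

    eval-line+k*n : ∀ c p f k → eval m (c ⊙ p ⊕ const f ⊕ k ⊙ (12 , N)) ≡ c * eval m p + f + k * n
    eval-line+k*n c p f k =
      trans (eval-⊕ m (c ⊙ p ⊕ const f) (k ⊙ (12 , N))) (cong₂ _+_ (eval-line c p f) (eval-⊙ m k (12 , N)))

    module _ {A B i j} (i∈A : Located m A i) (j∈B : Located m B j) (i<j : i < j) (ℓ : Line) where

      private
        c = step ℓ
        f = offset ℓ A
        f′ = offset ℓ B

        pull : ∀ c j f → c + (c * j + f) ≡ c * suc j + f
        pull = solve-∀

        pull+k*n : ∀ c i f x → c * i + (c + f) + x ≡ c + (c * i + f + x)
        pull+k*n = solve-∀

        pull+0 : ∀ c j f → c * j + (c + f) ≡ c + (c * j + f)
        pull+0 = solve-∀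

        open ≤-Reasoning

      -- Since `hi B` is exclusive, the sharp bound is j + 1 ≤ `hi B`; one `step` is added on both
      -- sides to avoid a predecessor.
      below-sound : ∀ {k} → Below ℓ A B k → value ℓ B j < value ℓ A i + k * n
      below-sound {k} lt = +-cancelˡ-< c _ _ (begin-strict
        c + (c * j + f′)                                            ≡⟨ pull c j f′ ⟩
        c * suc j + f′                                              ≤⟨ +-monoˡ-≤ f′ (*-monoʳ-≤ c (Located.<hi j∈B)) ⟩
        c * eval m (hi B) + f′                                      ≡⟨ eval-line c (hi B) f′ ⟨
        eval m (c ⊙ hi B ⊕ const f′)                               <⟨ eval-mono-≺ m lt ⟩
        eval m (c ⊙ lo A ⊕ const (c + f) ⊕ k ⊙ (12 , N))          ≡⟨ eval-line+k*n c (lo A) (c + f) k ⟩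
        c * eval m (lo A) + (c + f) + k * n                         ≤⟨ +-monoˡ-≤ (k * n) (+-monoˡ-≤ (c + f) (*-monoʳ-≤ c (Located.lo≤ i∈A))) ⟩
        c * i + (c + f) + k * n                                     ≡⟨ pull+k*n c i f (k * n) ⟩
        c + (c * i + f + k * n)                                     ∎)

      above-sound : ∀ {k} → Above ℓ A B k → value ℓ A i + k * n < value ℓ B j
      above-sound {k} lt = +-cancelˡ-< c _ _ (begin-strict
        c + (c * i + f + k * n)                                     ≡⟨ +-assoc c (c * i + f) (k * n) ⟨
        c + (c * i + f) + k * n                                     ≡⟨ cong (_+ k * n) (pull c i f) ⟩
        c * suc i + f + k * n                                       ≤⟨ +-monoˡ-≤ (k * n) (+-monoˡ-≤ f (*-monoʳ-≤ c (Located.<hi i∈A))) ⟩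
        c * eval m (hi A) + f + k * n                               ≡⟨ eval-line+k*n c (hi A) f k ⟨
        eval m (c ⊙ hi A ⊕ const f ⊕ k ⊙ (12 , N))                <⟨ eval-mono-≺ m lt ⟩
        eval m (c ⊙ lo B ⊕ const (c + f′))                         ≡⟨ eval-line c (lo B) (c + f′) ⟩
        c * eval m (lo B) + (c + f′)                                ≤⟨ +-monoˡ-≤ (c + f′) (*-monoʳ-≤ c (Located.lo≤ j∈B)) ⟩
        c * j + (c + f′)                                            ≡⟨ pull+0 c j f′ ⟩
        c + (c * j + f′)                                            ∎)

      -- The order i < j enters here, so two indices of the same piece are covered as well.
      near-sound : ∀ {x} → Near ℓ A B x → value ℓ A i < value ℓ B j + x
      near-sound {x} f< = begin-strict
        c * i + f             <⟨ +-monoʳ-< (c * i) f< ⟩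
        c * i + (c + f′ + x)  ≡⟨ regroup c i f′ x ⟩
        c * suc i + f′ + x    ≤⟨ +-monoˡ-≤ x (+-monoˡ-≤ f′ (*-monoʳ-≤ c i<j)) ⟩
        c * j + f′ + x        ∎
        where
        regroup : ∀ c i f x → c * i + (c + f + x) ≡ c * suc i + f + x
        regroup = solve-∀

      -- Modulo `step` the terms in i, j and 12m vanish, leaving only the offsets and k * N.
      incongruent-sound : ∀ {k} → Incongruent ℓ A B k → ¬ value ℓ B j ≡ value ℓ A i + k * n
      incongruent-sound {k} c∤ eq = c∤ (∣-distance (m∣m*n j) c∣rest (trans eq (regroup c i f k N m)))
        where
        regroup : ∀ c i f k N m → c * i + f + k * (N + m * 12) ≡ c * i + k * m * 12 + (f + k * N)
        regroup = solve-∀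
        c∣rest : c ∣ c * i + k * m * 12
        c∣rest = ∣m∣n⇒∣m+n (m∣m*n i) (∣n⇒∣m*n (k * m) (step∣12 ℓ))

      excluded-sound : ∀ {k} → Excluded ℓ A B k → ¬ value ℓ B j ≡ value ℓ A i + k * n
      excluded-sound {k} (inj₁ c∤)                      eq = incongruent-sound {k} c∤ eq
      excluded-sound (inj₂ (inj₁ (refl , near)))          eq =
        <-irrefl (sym (trans (+-identityʳ _) (trans eq (+-identityʳ _)))) (near-sound near)
      excluded-sound {k} (inj₂ (inj₂ (inj₁ above)))     eq = <-irrefl (sym eq) (above-sound {k} above)
      excluded-sound {k} (inj₂ (inj₂ (inj₂ below)))     eq = <-irrefl eq (below-sound {k} below)

      separatedOn-sound : SeparatedOn A B ℓ → ¬ value ℓ B j ≈ value ℓ A i [mod n ]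
      separatedOn-sound (near , far , excluded) vB≈vA with ≈⇒difference vB≈vA
      ... | inj₂ (k , eq) = <-irrefl eq (begin-strict
        value ℓ A i              <⟨ near-sound near ⟩
        value ℓ B j + N          ≤⟨ +-monoʳ-≤ (value ℓ B j) (m≤m+n N (m * 12)) ⟩
        value ℓ B j + n          ≤⟨ +-monoʳ-≤ (value ℓ B j) (m≤m+n n (k * n)) ⟩
        value ℓ B j + suc k * n  ∎)
      ... | inj₁ (k , eq) with k <? suc c
      ...   | yes k≤c = excluded-sound (All.lookup excluded (∈-upTo⁺ k≤c)) eq
      -- The bound at `suc c` persists for larger k, as k * n only grows.
      ...   | no  k≰c = <-irrefl eq (<-≤-trans (below-sound {suc c} far) (+-monoʳ-≤ (value ℓ A i) (*-monoˡ-≤ n (≮⇒≥ k≰c))))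

    separated-sound : ∀ {A B i j ℓ} → Separated A B → Located m A i → Located m B j → i < j →
                      ℓ ∈ lines → ¬ value ℓ B j ≈ value ℓ A i [mod n ]
    separated-sound (inj₁ B≼A)  i∈A j∈B i<j ℓ∈ =
      contradiction (<-trans i<j (<-≤-trans (Located.<hi j∈B) (≤-trans (eval-mono-≼ m B≼A) (Located.lo≤ i∈A)))) (<-irrefl refl)
    separated-sound {ℓ = ℓ} (inj₂ sep) i∈A j∈B i<j ℓ∈ = separatedOn-sound i∈A j∈B i<j ℓ (All.lookup sep ℓ∈)

-- The twelve configurations and their verification

-- The entry at index r serves n = 2 + r + 12m, whose n - 2 queens have indices
-- below r + 12m.  Adding a constant to every g only translates the rows; it keeps g ≥ 0.
configurations : Vec (List Run) 12
configurations =
    (run (6 , 0) 0 0 ∷ run (6 , 0) 1 5 ∷ [])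
  ∷ (run (2 , 0) 0 0 ∷ run (4 , 1) 1 0 ∷ run (2 , 0) 1 2 ∷ run (4 , 0) 1 4 ∷ [])
  ∷ (run (1 , 0) 0 0 ∷ run (3 , 1) 1 0 ∷ run (2 , 0) 1 2 ∷ run (3 , 1) 2 1 ∷ run (3 , 0) 2 3 ∷ [])
  ∷ (run (12 , 3) 0 0 ∷ [])
  ∷ (run (2 , 0) 0 2 ∷ run (0 , 1) 1 1 ∷ run (4 , 2) 1 0 ∷ run (2 , 0) 1 1 ∷ run (4 , 1) 1 5 ∷ [])
  ∷ (run (12 , 5) 0 0 ∷ [])
  ∷ (run (3 , 2) 0 1 ∷ run (1 , 1) 0 0 ∷ run (3 , 1) 0 2 ∷ run (2 , 1) 1 2 ∷ run (3 , 1) 1 5 ∷ [])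
  ∷ (run (2 , 1) 0 0 ∷ run (4 , 3) 1 0 ∷ run (2 , 1) 1 2 ∷ run (4 , 2) 1 4 ∷ [])
  ∷ (run (6 , 5) 0 0 ∷ run (6 , 3) 0 3 ∷ [])
  ∷ (run (12 , 9) 0 0 ∷ [])
  ∷ (run (1 , 1) 0 1 ∷ run (1 , 1) 1 0 ∷ run (2 , 2) 1 1 ∷ run (3 , 2) 1 2 ∷ run (1 , 0) 1 5 ∷ run (2 , 2) 2 6 ∷ run (2 , 2) 2 5 ∷ [])
  ∷ (run (12 , 11) 0 0 ∷ [])
  ∷ []

origin : Affine
origin = 0 , 0

layout : Fin 12 → List Piece
layout r = pieces origin (lookup configurations r)

open Separation using (Separated; separated?; separated-sound)

abstract
  -- Decided by evaluation. No m occurs, so one finite check settles a whole residue class of n;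
  -- `abstract` keeps it from being unfolded later.
  layout-separated : ∀ r → All (λ A → All (Separated (2 + toℕ r) A) (layout r)) (layout r)
  layout-separated = from-yes (Fin.all? λ r → all? (λ A → all? (separated? (2 + toℕ r) A) (layout r)) (layout r))

  -- The lengths add up to r + 12m = n - 2, so every queen index falls into some piece.
  layout-end : ∀ r → end origin (lookup configurations r) ≡ (12 , toℕ r)
  layout-end = from-yes (Fin.all? λ r → ≡-dec _≟_ _≟_ (end origin (lookup configurations r)) (12 , toℕ r))

-- From conflicts on the board to congruent line values

module _ (n : ℕ) .{{_ : NonZero n}} where

  queen : Piece → ℕ → Field n
  queen A i = value column A i mod n , value row A i mod n

  sumMod≡⇒≈ : ∀ A i B j → sumMod n (value column A i mod n) (value row A i mod n) ≡
                            sumMod n (value column B j mod n) (value row B j mod n) →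
              value sum A i ≈ value sum B j [mod n ]
  sumMod≡⇒≈ A i B j eq = ≈-trans (≈-sym (sum≈ A i)) (≈-trans (%≡⇒≈ eq) (sum≈ B j))
    where
    sum≈ : ∀ A i → toℕ (value column A i mod n) + toℕ (value row A i mod n) ≈ value sum A i [mod n ]
    sum≈ A i = ≈-trans (≈-+-cong (mod≈ (value column A i)) (mod≈ (value row A i))) (≈-reflexive (column+row A i))

  -- diffMod is column minus row, so it is complementary to the line difference.
  diffMod≡⇒≈ : ∀ A i B j → diffMod n (value column A i mod n) (value row A i mod n) ≡
                             diffMod n (value column B j mod n) (value row B j mod n) →
               value difference A i ≈ value difference B j [mod n ]
  diffMod≡⇒≈ A i B j eq = ≈-+-cancelʳ (diff A i)
    (≈-trans (difference+diff A i) (≈-sym (≈-trans (≈-+-congˡ (value difference B j) (%≡⇒≈ eq)) (difference+diff B j))))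
    where
    diff : Piece → ℕ → ℕ
    diff A i = toℕ (value column A i mod n) + (n ∸ toℕ (value row A i mod n))
    -- Difference plus column is the row, which cancels against `n ∸ y`; this subtraction is exact
    -- because y < n.
    difference+diff : ∀ A i → value difference A i + diff A i ≈ n [mod n ]
    difference+diff A i =
      ≈-trans (≈-+-congˡ w (≈-+-congʳ (n ∸ y) (mod≈ x)))
      (≈-trans (≈-reflexive (trans (sym (+-assoc w x (n ∸ y))) (cong (_+ (n ∸ y)) (difference+column A i))))
      (≈-trans (≈-+-congʳ (n ∸ y) (≈-sym (mod≈ (value row A i))))
               (≈-reflexive (m+[n∸m]≡n (<⇒≤ (Fin.toℕ<n (value row A i mod n)))))))
      where
      w x y : ℕ
      w = value difference A i
      x = value column A i
      y = toℕ (value row A i mod n)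

  conflict⇒≈ : ∀ A i B j → Conflict n (queen A i) (queen B j) →
               ∃ λ ℓ → ℓ ∈ lines × value ℓ A i ≈ value ℓ B j [mod n ]
  conflict⇒≈ A i B j (inj₁ x≡)                 = column , here refl , mod≡⇒≈ x≡
  conflict⇒≈ A i B j (inj₂ (inj₁ y≡))          = row , there (there (here refl)) , mod≡⇒≈ y≡
  conflict⇒≈ A i B j (inj₂ (inj₂ (inj₁ s≡)))   = sum , there (there (there (here refl))) , sumMod≡⇒≈ A i B j s≡
  conflict⇒≈ A i B j (inj₂ (inj₂ (inj₂ d≡)))   = difference , there (here refl) , diffMod≡⇒≈ A i B j d≡

-- Placing the n - 2 queens

placement : ∀ m r → let k = toℕ r + m * 12 in Σ (Fin k → Field (2 + k)) (NonAttacking (2 + k) k)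
placement m r = q , injective , nonConflicting
  where
  k n : ℕ
  k = toℕ r + m * 12
  n = 2 + k

  site : ∀ i → ∃ λ A → A ∈ layout r × Located m A (toℕ i)
  site i = locate m origin (lookup configurations r) (toℕ i)
    (≤-trans (≤-reflexive (*-zeroʳ m)) z≤n)
    (subst (λ p → toℕ i < eval m p) (sym (layout-end r)) (Fin.toℕ<n i))

  q : Fin k → Field n
  q i = queen n (proj₁ (site i)) (toℕ i)

  separate : ∀ {ℓ} i j → toℕ i < toℕ j → ℓ ∈ lines →
             ¬ value ℓ (proj₁ (site j)) (toℕ j) ≈ value ℓ (proj₁ (site i)) (toℕ i) [mod n ]
  separate i j i<j ℓ∈ with A , A∈ , i∈A ← site i | B , B∈ , j∈B ← site j =
    separated-sound (2 + toℕ r) m (All.lookup (All.lookup (layout-separated r) A∈) B∈) i∈A j∈B i<j ℓ∈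

  nonConflicting : ∀ i j → ¬ i ≡ j → ¬ Conflict n (q i) (q j)
  nonConflicting i j i≢j conflict
    with ℓ , ℓ∈ , v≈ ← conflict⇒≈ n (proj₁ (site i)) (toℕ i) (proj₁ (site j)) (toℕ j) conflict
    with <-cmp (toℕ i) (toℕ j)
  ... | tri< i<j _ _ = separate i j i<j ℓ∈ (≈-sym v≈)
  ... | tri≈ _ i≡j _ = i≢j (Fin.toℕ-injective i≡j)
  ... | tri> _ _ j<i = separate j i j<i ℓ∈ v≈

  injective : ∀ i j → q i ≡ q j → i ≡ j
  injective i j qi≡qj with i Fin.≟ j
  ... | yes i≡j = i≡j
  -- Equal fields share a column, which is already a conflict.
  ... | no  i≢j = contradiction (inj₁ (cong proj₁ qi≡qj)) (nonConflicting i j i≢j)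

theorem1 : (n : ℕ) .{{_ : NonZero n}} → 2 ≤ n →
    Σ (Fin (n ∸ 2) → Field n) (λ q → NonAttacking n (n ∸ 2) q)
-- Dividing n - 2 rather than n by 12 makes r the constant term of the number of queens.
theorem1 (suc (suc k)) _ with result m r k≡ ← k divMod 12 =
  subst (λ k → Σ (Fin k → Field (2 + k)) (NonAttacking (2 + k) k)) (sym k≡) (placement m r)
theorem1 1 (s≤s ())
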